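{- Let $d\geq 0$, $n_0\geq 1$ and $k\geq 1$ be integers. Every graph $G$ with $\operatorname{mad}(G,n_0)<\frac{2d+2}{d+2}\, k$ is $k$-choosable with defect $d':=\max \{\lceil \frac{n_0-1}{k}\rceil-1,\,d\}$.
   Context: Graphs are finite and simple. For a graph $G$ and integer $n_0\geq 1$, $\operatorname{mad}(G,n_0)$ is the maximum average degree of a subgraph of $G$ with at least $n_0$ vertices, unless $|V(G)|<n_0$, in which case $\operatorname{mad}(G,n_0):=0$. In a coloured graph the monochromatic subgraph is the spanning subgraph of edges whose endpoints have the same colour. A colouring has defect $d$ if the monochromatic subgraph has maximum degree at most $d$. A $k$-list-assignment $L$ assigns to each vertex $v$ a set $L(v)$ of at least $k$ colours; an $L$-colouring colours each $v$ with a colour from $L(v)$. $G$ is $k$-choosable with defect $d$ if for every $k$-list-assignment $L$, $G$ has an $L$-colouring with defect $d$. -}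

module Defs where

open import Data.Bool using (Bool; true; false; _∧_)
open import Data.Nat using (ℕ; zero; suc; _+_; _*_; _∸_; _≤_; _<_; _⊔_; _≡ᵇ_; NonZero)
open import Data.Nat.DivMod using (_/_)
open import Data.Fin using (Fin) renaming (zero to Fz; suc to Fs)
open import Data.List using (List; length)
open import Data.List.Membership.Propositional using (_∈_)
open import Data.List.Relation.Unary.Unique.Propositional using (Unique)
open import Data.Product using (_×_)
open import Relation.Binary.PropositionalEquality using (_≡_)

count : {n : ℕ} → (Fin n → Bool) → ℕ
count {zero}  p = 0
count {suc n} p = (if' p Fz) + count {n} (λ i → p (Fs i))
  where
    if' : (Fin (suc n) → Bool) → Fin (suc n) → ℕ
    if' q i with q i
    ... | true  = 1
    ... | false = 0

sumF : {n : ℕ} → (Fin n → ℕ) → ℕ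
sumF {zero}  f = 0
sumF {suc n} f = f Fz + sumF {n} (λ i → f (Fs i))

record Graph : Set where
  field
    n     : ℕ
    adj   : Fin n → Fin n → Bool
    sym   : ∀ u v → adj u v ≡ adj v u
    irref : ∀ v → adj v v ≡ false
open Graph public

record Subgraph (G : Graph) : Set where
  field
    vert  : Fin (n G) → Bool
    edge  : Fin (n G) → Fin (n G) → Bool
    esym  : ∀ u v → edge u v ≡ edge v u
    eInG  : ∀ u v → edge u v ≡ true → adj G u v ≡ true
    eVert : ∀ u v → edge u v ≡ true → (vert u ≡ true) × (vert v ≡ true)
open Subgraph public

numVert : {G : Graph} → Subgraph G → ℕ
numVert H = count (vert H)

degIn : {G : Graph} → Subgraph G → Fin (n G) → ℕ
degIn H v = count (edge H v)

degSum : {G : Graph} → Subgraph G → ℕ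
degSum H = sumF (degIn H)

-- mad(G, n0) < (num / den), den ≥ 1: every subgraph H with at least n0
-- vertices has average degree degSum H / |V(H)| < num / den
-- (cross-multiplied; |V(H)| ≥ n0 ≥ 1 and den ≥ 1).  If |V(G)| < n0 there is
-- no such H, matching mad(G,n0) = 0 < num/den when num > 0.
MadLess : Graph → (n0 num den : ℕ) → Set
MadLess G n0 num den =
  (H : Subgraph G) → n0 ≤ numVert H → degSum H * den < num * numVert H

record ListAssignment (G : Graph) (k : ℕ) : Set where
  field
    lists  : Fin (n G) → List ℕ
    unique : ∀ v → Unique (lists v)
    big    : ∀ v → k ≤ length (lists v)
open ListAssignment public

IsLColouring : {G : Graph} {k : ℕ} → ListAssignment G k → (Fin (n G) → ℕ) → Set
IsLColouring {G} L c = ∀ v → c v ∈ lists L v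

monoDeg : (G : Graph) → (Fin (n G) → ℕ) → Fin (n G) → ℕ
monoDeg G c v = count (λ u → adj G v u ∧ (c u ≡ᵇ c v))

HasDefect : (G : Graph) → (Fin (n G) → ℕ) → ℕ → Set
HasDefect G c d = ∀ v → monoDeg G c v ≤ d

ChoosableWithDefect : Graph → (k d : ℕ) → Set
ChoosableWithDefect G k d =
  (L : ListAssignment G k) → Σ' (Fin (n G) → ℕ) (λ c → IsLColouring L c × HasDefect G c d)
  where
    open import Data.Product using () renaming (Σ to Σ')

-- ⌈ m / k ⌉ for k ≥ 1 (value at k = 0 is an irrelevant convention)
ceilDiv : ℕ → ℕ → ℕ
ceilDiv m zero    = 0
ceilDiv m (suc k) = (m + k) / suc k

{-# OPTIONS --safe #-}

-- Call a nonempty A ⊆ S reducible if deg_A v + (d+1) deg_{S∖A} v < (d+1) k for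
-- all v ∈ A.  Any colouring of S ∖ A then extends to S: minimise the total
-- weight of monochromatic edges, where edges inside A weigh 1 and edges between
-- A and S ∖ A weigh d + 1.  At a minimum each v ∈ A has monochromatic weight at
-- most d, so no monochromatic edge leaves A.
-- If S has no reducible subset, repeatedly delete from A (initially S) a vertex
-- v with (d+1) k ≤ (d+1) deg_S v − d deg_A v.  Summing over all deletions gives
-- (d+1) k |S| ≤ (d+2) e(S), against the sparsity hypothesis when |S| ≥ n₀.  When
-- |S| < n₀, all of S is reducible with the defect d′ in place of d.
module Submission where

open import Defs hiding (sym)
open import Data.Nat using (ℕ; suc; _+_; _*_; _∸_; _≤_; _⊔_)
open import Data.Nat using (zero; _<_; _≤?_; _≡ᵇ_; z≤n; s≤s)
open import Data.Nat.Properties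
open import Data.Nat.DivMod using (_/_; _%_; m≡m%n+[m/n]*n; m%n<n)
open import Data.Nat.Induction using (<-rec)
open import Data.Nat.Tactic.RingSolver using (solve-∀)
open import Data.Bool using (Bool; true; false; _∧_; not; T)
open import Data.Bool.Properties using (∧-identityʳ; ∧-comm; ∧-zeroʳ)
  renaming (_≟_ to _≟ᵇ_)
open import Data.Fin using (Fin) renaming (zero to Fz; suc to Fs)
open import Data.Fin.Properties using (any?) renaming (_≟_ to _≟ᶠ_)
open import Data.List using (List; []; _∷_; length)
open import Data.List.Membership.Propositional using (_∈_)
open import Data.List.Relation.Unary.Any using (here; there)
open import Data.List.Relation.Unary.All using (All; []; _∷_)
open import Data.List.Relation.Unary.AllPairs using ([]; _∷_)
open import Data.List.Relation.Unary.Unique.Propositional using (Unique)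
open import Data.Vec.Functional using (updateAt)
open import Data.Vec.Functional.Properties using (updateAt-updates; updateAt-minimal)
open import Data.Product using (Σ; ∃; ∃-syntax; _×_; _,_; proj₁; proj₂)
open import Data.Sum using (_⊎_; inj₁; inj₂)
open import Data.Unit using (tt)
open import Function using (const; _∘_)
open import Relation.Nullary using (yes; no; contradiction)
open import Relation.Nullary.Decidable using (_×-dec_)
open import Relation.Binary.PropositionalEquality
  using (_≡_; _≢_; refl; sym; trans; cong; cong₂; subst; module ≡-Reasoning)

-- Indicators and finite sums.

⟦_⟧ : Bool → ℕ
⟦ true ⟧  = 1
⟦ false ⟧ = 0

⟦∧⟧ : ∀ b b′ → ⟦ b ∧ b′ ⟧ ≡ ⟦ b ⟧ * ⟦ b′ ⟧
⟦∧⟧ true  b′ = sym (+-identityʳ _)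
⟦∧⟧ false b′ = refl

≡ᵇ-sym : ∀ x y → (x ≡ᵇ y) ≡ (y ≡ᵇ x)
≡ᵇ-sym zero    zero    = refl
≡ᵇ-sym zero    (suc y) = refl
≡ᵇ-sym (suc x) zero    = refl
≡ᵇ-sym (suc x) (suc y) = ≡ᵇ-sym x y

sumF-cong : ∀ {n} {f g : Fin n → ℕ} → (∀ i → f i ≡ g i) → sumF f ≡ sumF g
sumF-cong {zero}  f≡g = refl
sumF-cong {suc n} f≡g = cong₂ _+_ (f≡g Fz) (sumF-cong (f≡g ∘ Fs))

sumF-mono : ∀ {n} {f g : Fin n → ℕ} → (∀ i → f i ≤ g i) → sumF f ≤ sumF g
sumF-mono {zero}  f≤g = z≤n
sumF-mono {suc n} f≤g = +-mono-≤ (f≤g Fz) (sumF-mono (f≤g ∘ Fs))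

sumF-0 : ∀ {n} {f : Fin n → ℕ} → (∀ i → f i ≡ 0) → sumF f ≡ 0
sumF-0 {zero}  f≡0 = refl
sumF-0 {suc n} f≡0 = cong₂ _+_ (f≡0 Fz) (sumF-0 (f≡0 ∘ Fs))

sumF-+ : ∀ {n} (f g : Fin n → ℕ) → sumF (λ i → f i + g i) ≡ sumF f + sumF g
sumF-+ {zero}  f g = refl
sumF-+ {suc n} f g = trans (cong (f Fz + g Fz +_) (sumF-+ (f ∘ Fs) (g ∘ Fs)))
  (interchange (f Fz) (g Fz) _ _)
  where
  interchange : ∀ a b c d → a + b + (c + d) ≡ a + c + (b + d)
  interchange = solve-∀

sumF-* : ∀ {n} m (f : Fin n → ℕ) → sumF (λ i → m * f i) ≡ m * sumF f
sumF-* {zero}  m f = sym (*-zeroʳ m)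
sumF-* {suc n} m f = trans (cong (m * f Fz +_) (sumF-* m (f ∘ Fs)))
  (sym (*-distribˡ-+ m (f Fz) _))

term≤sumF : ∀ {n} (f : Fin n → ℕ) i → f i ≤ sumF f
term≤sumF f Fz     = m≤m+n _ _
term≤sumF f (Fs i) = ≤-trans (term≤sumF (f ∘ Fs) i) (m≤n+m _ _)

count≡sumF : ∀ {n} (p : Fin n → Bool) → count p ≡ sumF (λ i → ⟦ p i ⟧)
count≡sumF {zero}  p = refl
count≡sumF {suc n} p with p Fz
... | true  = cong suc (count≡sumF (p ∘ Fs))
... | false = count≡sumF (p ∘ Fs)

-- Each side is the common sum away from `v` plus both entries at `v`; adding the missing entry to
-- either side avoids subtraction in ℕ.
sumF-change : ∀ {n} (f g : Fin n → ℕ) v → (∀ u → u ≢ v → f u ≡ g u) →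
  sumF f + g v ≡ sumF g + f v
sumF-change {suc n} f g Fz f≡g =
  trans (cong (λ s → f Fz + s + g Fz) (sumF-cong (λ i → f≡g (Fs i) λ ())))
    (swap (f Fz) _ (g Fz))
  where
  swap : ∀ a s b → a + s + b ≡ b + s + a
  swap = solve-∀
sumF-change {suc n} f g (Fs v) f≡g = begin
  f Fz + sumF (f ∘ Fs) + g (Fs v)    ≡⟨ +-assoc (f Fz) _ _ ⟩
  f Fz + (sumF (f ∘ Fs) + g (Fs v))  ≡⟨ cong₂ _+_ (f≡g Fz λ ())
    (sumF-change (f ∘ Fs) (g ∘ Fs) v λ u u≢v → f≡g (Fs u) λ where refl → u≢v refl) ⟩
  g Fz + (sumF (g ∘ Fs) + f (Fs v))  ≡⟨ +-assoc (g Fz) _ _ ⟨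
  g Fz + sumF (g ∘ Fs) + f (Fs v)    ∎
  where open ≡-Reasoning

-- With both sides moved so that no subtraction occurs.
sumF²-change : ∀ {n} (f g : Fin n → Fin n → ℕ) v →
  (∀ u x → f u x ≡ f x u) → (∀ u x → g u x ≡ g x u) →
  f v v ≡ 0 → g v v ≡ 0 →
  (∀ u x → u ≢ v → x ≢ v → f u x ≡ g u x) →
  sumF (λ u → sumF (f u)) + 2 * sumF (g v) ≡ sumF (λ u → sumF (g u)) + 2 * sumF (f v)
sumF²-change f g v fsym gsym fvv gvv f≡g = begin
  sumF (λ u → sumF (f u)) + 2 * sumF (g v)  ≡⟨ expand f g gsym gvv fvv ⟩
  sumF F + G v                              ≡⟨ sumF-change F G v F≡G ⟩
  sumF G + F v                              ≡⟨ expand g f fsym fvv gvv ⟨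
  sumF (λ u → sumF (g u)) + 2 * sumF (f v)  ∎
  where
  open ≡-Reasoning
  -- Rows `u ≢ v` of `f` and `g` differ only in column `v`. Adding the other matrix's entry there
  -- makes `F` and `G` agree off `v`, so that `sumF-change` applies once more, to the rows.
  F G : Fin _ → ℕ
  F u = sumF (f u) + g u v
  G u = sumF (g u) + f u v
  F≡G : ∀ u → u ≢ v → F u ≡ G u
  F≡G u u≢v = sumF-change (f u) (g u) v (λ x x≢v → f≡g u x u≢v x≢v)
  rearrange : ∀ a b → a + 2 * b ≡ a + b + (b + 0)
  rearrange = solve-∀
  -- Of the two copies of `sumF (g v)`, one becomes column `v` by symmetry and is spread over the
  -- rows; the other stays as row `v`, padded with `f v v`, which is 0.
  expand : ∀ (f g : Fin _ → Fin _ → ℕ) → (∀ u x → g u x ≡ g x u) → g v v ≡ 0 → f v v ≡ 0 →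
    sumF (λ u → sumF (f u)) + 2 * sumF (g v)
      ≡ sumF (λ u → sumF (f u) + g u v) + (sumF (g v) + f v v)
  expand f g gsym gvv fvv = begin
    sumF (λ u → sumF (f u)) + 2 * sumF (g v)
      ≡⟨ rearrange (sumF (λ u → sumF (f u))) (sumF (g v)) ⟩
    sumF (λ u → sumF (f u)) + sumF (g v) + (sumF (g v) + 0)
      ≡⟨ cong₂ (λ s z → sumF (λ u → sumF (f u)) + s + (sumF (g v) + z))
           (sumF-cong (gsym v)) (sym fvv) ⟩
    sumF (λ u → sumF (f u)) + sumF (λ u → g u v) + (sumF (g v) + f v v)
      ≡⟨ cong (_+ (sumF (g v) + f v v)) (sumF-+ (λ u → sumF (f u)) (λ u → g u v)) ⟨
    sumF (λ u → sumF (f u) + g u v) + (sumF (g v) + f v v)  ∎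

-- Sums over colour lists and Lovász recolouring.

sumL : List ℕ → (ℕ → ℕ) → ℕ
sumL []       f = 0
sumL (x ∷ xs) f = f x + sumL xs f

sumL-swap : ∀ {n} l (f : Fin n → ℕ → ℕ) →
  sumL l (λ x → sumF (λ u → f u x)) ≡ sumF (λ u → sumL l (f u))
sumL-swap {n} [] f = sym (sumF-0 {n} λ _ → refl)
sumL-swap (x ∷ l) f = trans (cong (sumF (λ u → f u x) +_) (sumL-swap l f))
  (sym (sumF-+ (λ u → f u x) (λ u → sumL l (f u))))

sumL-indicator-absent : ∀ w y l → All (y ≢_) l → sumL l (λ x → w * ⟦ y ≡ᵇ x ⟧) ≡ 0
sumL-indicator-absent w y [] [] = refl
sumL-indicator-absent w y (x ∷ l) (y≢x ∷ ps) with y ≡ᵇ x in eq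
... | true  = contradiction (≡ᵇ⇒≡ y x (subst T (sym eq) tt)) y≢x
... | false = cong₂ _+_ (*-zeroʳ w) (sumL-indicator-absent w y l ps)

-- At most one entry of a repetition-free list equals `y`. Distinctness of the colours in a list
-- enters the argument here.
sumL-indicator : ∀ w y l → Unique l → sumL l (λ x → w * ⟦ y ≡ᵇ x ⟧) ≤ w
sumL-indicator w y [] [] = z≤n
sumL-indicator w y (x ∷ l) (x∉l ∷ ul) with y ≡ᵇ x in eq
... | false rewrite *-zeroʳ w = sumL-indicator w y l ul
... | true with refl ← ≡ᵇ⇒≡ y x (subst T (sym eq) tt) = ≤-reflexive (begin
    w * 1 + sumL l (λ z → w * ⟦ y ≡ᵇ z ⟧)
      ≡⟨ cong₂ _+_ (*-identityʳ w) (sumL-indicator-absent w y l x∉l) ⟩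
    w + 0  ≡⟨ +-identityʳ w ⟩
    w      ∎)
  where open ≡-Reasoning

-- Averaging: an entry with value above `d` uses up at least its share `suc d` of the bound, so the
-- strict inequality passes to the tail and must fail at the empty list.
pigeonhole : ∀ d l (f : ℕ → ℕ) → sumL l f < suc d * length l → ∃[ x ] x ∈ l × f x ≤ d
pigeonhole d [] f lt rewrite *-zeroʳ d = contradiction lt λ ()
pigeonhole d (x ∷ l) f lt with f x ≤? d
... | yes fx≤d = x , here refl , fx≤d
... | no fx≰d =
  let y , y∈l , fy≤d = pigeonhole d l f (+-cancelˡ-< (suc d) _ _ (begin-strict
        suc d + sumL l f        ≤⟨ +-monoˡ-≤ _ (≰⇒> fx≰d) ⟩
        f x + sumL l f          <⟨ lt ⟩
        suc d * suc (length l)  ≡⟨ *-suc (suc d) (length l) ⟩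
        suc d + suc d * length l ∎))
  in y , there y∈l , fy≤d
  where open ≤-Reasoning

-- Recolouring a vertex of A with too large a monochromatic weight strictly
-- decreases the total monochromatic weight (Lovász).
recolour : ∀ {n} d (ω : Fin n → Fin n → ℕ) →
  (∀ u v → ω u v ≡ ω v u) → (∀ v → ω v v ≡ 0) →
  (ℓ : Fin n → List ℕ) → (∀ v → Unique (ℓ v)) →
  (A : Fin n → Bool) →
  (∀ v → A v ≡ true → sumF (ω v) < suc d * length (ℓ v)) →
  (c : Fin n → ℕ) → (∀ v → c v ∈ ℓ v) →
  ∃[ c′ ] (∀ v → c′ v ∈ ℓ v) × (∀ v → A v ≡ false → c′ v ≡ c v) ×
    (∀ v → A v ≡ true → sumF (λ u → ω v u * ⟦ c′ u ≡ᵇ c′ v ⟧) ≤ d)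
recolour {n} d ω ωsym ωirr ℓ ℓuniq A small c₀ c₀∈ =
  <-rec Goal step (Φ c₀) c₀ c₀∈ refl
  where
  mono : (Fin n → ℕ) → Fin n → Fin n → ℕ
  mono c v u = ω v u * ⟦ c u ≡ᵇ c v ⟧
  -- Summing over ordered pairs counts every monochromatic edge twice, hence the factor 2 in
  -- `change`.
  Φ : (Fin n → ℕ) → ℕ
  Φ c = sumF (λ v → sumF (mono c v))
  Goal : ℕ → Set
  Goal m = ∀ c → (∀ v → c v ∈ ℓ v) → Φ c ≡ m →
    ∃[ c′ ] (∀ v → c′ v ∈ ℓ v) × (∀ v → A v ≡ false → c′ v ≡ c v) ×
      (∀ v → A v ≡ true → sumF (mono c′ v) ≤ d)
  mono-sym : ∀ c u v → mono c u v ≡ mono c v u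
  mono-sym c u v = cong₂ _*_ (ωsym u v) (cong ⟦_⟧ (≡ᵇ-sym (c v) (c u)))
  mono-irr : ∀ c v → mono c v v ≡ 0
  mono-irr c v rewrite ωirr v = refl

  step : ∀ m → (∀ {m′} → m′ < m → Goal m′) → Goal m
  step m rec c c∈ refl with any? (λ v → A v ≟ᵇ true ×-dec suc d ≤? sumF (mono c v))
  ... | no none = c , c∈ , (λ _ _ → refl) , λ v Av → ≮⇒≥ λ lt → none (v , Av , lt)
  ... | yes (v , Av , lt) =
    let x , x∈ , cost≤d = pigeonhole d (ℓ v) cost (≤-<-trans total (small v Av))
        c₁∈ , c₁off , Φ<   = improve x x∈ cost≤d
        c₂ , c₂∈ , c₂off , ok = rec Φ< (updateAt c v (const x)) c₁∈ refl
    in c₂ , c₂∈ , (λ u Au → trans (c₂off u Au) (c₁off u Au)) , ok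
    where
    cost : ℕ → ℕ
    cost x = sumF (λ u → ω v u * ⟦ c u ≡ᵇ x ⟧)
    -- Each `u` charges its weight to at most one colour of `ℓ v`. The costs therefore sum to less
    -- than `suc d * length (ℓ v)`, and some colour costs at most `d`.
    total : sumL (ℓ v) cost ≤ sumF (ω v)
    total = ≤-trans (≤-reflexive (sumL-swap (ℓ v) λ u x → ω v u * ⟦ c u ≡ᵇ x ⟧))
      (sumF-mono λ u → sumL-indicator (ω v u) (c u) (ℓ v) (ℓuniq v))
    improve : ∀ x → x ∈ ℓ v → cost x ≤ d → let c₁ = updateAt c v (const x) in
      (∀ u → c₁ u ∈ ℓ u) × (∀ u → A u ≡ false → c₁ u ≡ c u) × Φ c₁ < Φ c
    improve x x∈ cost≤d = c₁∈ , c₁off , Φ<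
      where
      c₁ = updateAt c v (const x)
      at : c₁ v ≡ x
      at = updateAt-updates v c
      off : ∀ u → u ≢ v → c₁ u ≡ c u
      off u u≢v = updateAt-minimal u v c u≢v
      c₁∈ : ∀ u → c₁ u ∈ ℓ u
      c₁∈ u with u ≟ᶠ v
      ... | yes refl = subst (_∈ ℓ u) (sym at) x∈
      ... | no u≢v   = subst (_∈ ℓ u) (sym (off u u≢v)) (c∈ u)
      c₁off : ∀ u → A u ≡ false → c₁ u ≡ c u
      c₁off u Au = off u λ where refl → contradiction (trans (sym Av) Au) λ ()
      -- At `u = v` the two colour comparisons may differ, but the weight `ω v v` is 0.
      row : ∀ u → mono c₁ v u ≡ ω v u * ⟦ c u ≡ᵇ x ⟧
      row u with u ≟ᶠ v
      ... | yes refl rewrite ωirr u = refl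
      ... | no u≢v   = cong₂ (λ y z → ω v u * ⟦ y ≡ᵇ z ⟧) (off u u≢v) at
      row≤d : sumF (mono c₁ v) ≤ d
      row≤d = ≤-trans (≤-reflexive (sumF-cong row)) cost≤d
      change : Φ c + 2 * sumF (mono c₁ v) ≡ Φ c₁ + 2 * sumF (mono c v)
      change = sumF²-change (mono c) (mono c₁) v (mono-sym c) (mono-sym c₁)
        (mono-irr c v) (mono-irr c₁ v)
        λ u y u≢v y≢v → cong₂ (λ a b → ω u y * ⟦ a ≡ᵇ b ⟧)
          (sym (off y y≢v)) (sym (off u u≢v))
      -- Only row and column `v` change, and the row sum falls from at least `suc d` to at most `d`.
      Φ< : Φ c₁ < Φ c
      Φ< = +-cancelʳ-< (2 * sumF (mono c v)) _ _ (begin-strict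
        Φ c₁ + 2 * sumF (mono c v)  ≡⟨ change ⟨
        Φ c + 2 * sumF (mono c₁ v)  <⟨ +-monoʳ-< (Φ c) (*-monoʳ-< 2 (≤-<-trans row≤d lt)) ⟩
        Φ c + 2 * sumF (mono c v)   ∎)
        where open ≤-Reasoning

-- Vertex sets, edge weights and induced subgraphs.

size : ∀ {n} → (Fin n → Bool) → ℕ
size A = sumF (λ v → ⟦ A v ⟧)

infix 4 _⊆_
_⊆_ : ∀ {n} → (Fin n → Bool) → (Fin n → Bool) → Set
A ⊆ S = ∀ v → A v ≡ true → S v ≡ true

_∖_ : ∀ {n} → (Fin n → Bool) → (Fin n → Bool) → Fin n → Bool
(S ∖ A) v = S v ∧ not (A v)

size-∖ : ∀ {n} {S A : Fin n → Bool} → A ⊆ S → size (S ∖ A) + size A ≡ size S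
size-∖ {S = S} {A} A⊆S = trans (sym (sumF-+ (λ v → ⟦ (S ∖ A) v ⟧) (λ v → ⟦ A v ⟧)))
  (sumF-cong pointwise)
  where
  pointwise : ∀ v → ⟦ S v ∧ not (A v) ⟧ + ⟦ A v ⟧ ≡ ⟦ S v ⟧
  pointwise v with A v in Av
  ... | true rewrite A⊆S v Av = refl
  ... | false rewrite ∧-identityʳ (S v) = +-identityʳ _

-- The value `suc d` is the least that alone exceeds the allowed total `d`. Pairs with both ends
-- outside the set get 0, since neither end is recoloured.
weight : ℕ → Bool → Bool → ℕ
weight d true  true  = 1
weight d true  false = suc d
weight d false true  = suc d
weight d false false = 0

weight-sym : ∀ d a b → weight d a b ≡ weight d b a
weight-sym d true  true  = refl
weight-sym d true  false = refl
weight-sym d false true  = refl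
weight-sym d false false = refl

module _ (G : Graph) where

  private
    V : Set
    V = Fin (n G)

  edgeOn : (V → Bool) → V → V → Bool
  edgeOn S v u = (S v ∧ S u) ∧ adj G v u

  edgeOn-sym : ∀ S v u → edgeOn S v u ≡ edgeOn S u v
  edgeOn-sym S v u = cong₂ _∧_ (∧-comm (S v) (S u)) (Graph.sym G v u)

  edgeOn-irr : ∀ S v → edgeOn S v v ≡ false
  edgeOn-irr S v = trans (cong ((S v ∧ S v) ∧_) (irref G v)) (∧-zeroʳ _)

  induced : (V → Bool) → Subgraph G
  induced S = record
    { vert  = S
    ; edge  = edgeOn S
    ; esym  = edgeOn-sym S
    ; eInG  = eInG′
    ; eVert = eVert′
    }
    where
    eInG′ : ∀ u v → edgeOn S u v ≡ true → adj G u v ≡ true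
    eInG′ u v e with S u ∧ S v
    ... | true = e
    eVert′ : ∀ u v → edgeOn S u v ≡ true → (S u ≡ true) × (S v ≡ true)
    eVert′ u v e with S u | S v
    ... | true | true = refl , refl

  module _ (S A : V → Bool) (d : ℕ) where

    crossWeight : V → V → ℕ
    crossWeight v u = ⟦ edgeOn S v u ⟧ * weight d (A v) (A u)

    crossWeight-sym : ∀ u v → crossWeight u v ≡ crossWeight v u
    crossWeight-sym u v =
      cong₂ _*_ (cong ⟦_⟧ (edgeOn-sym S u v)) (weight-sym d (A u) (A v))

    crossWeight-irr : ∀ v → crossWeight v v ≡ 0
    crossWeight-irr v rewrite edgeOn-irr S v = refl

    Reducible : ℕ → Set
    Reducible k = ∀ v → A v ≡ true → sumF (crossWeight v) < suc d * k

  -- Extending a colouring over a reducible set.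

  module _ {k : ℕ} (L : ListAssignment G k) (d′ : ℕ) where

    -- The colouring is total and respects the lists everywhere; only the defect condition depends
    -- on `S`. Thus no partial functions arise, and `recolour` can start from any such colouring.
    Colourable : (V → Bool) → Set
    Colourable S = Σ (V → ℕ) λ c → (∀ v → c v ∈ lists L v) ×
      (∀ v → S v ≡ true → sumF (λ u → ⟦ edgeOn S v u ∧ (c u ≡ᵇ c v) ⟧) ≤ d′)

    -- After recolouring, a vertex of `A` has at most `d` monochromatic neighbours in `S`, because
    -- all its weights are at least 1. A vertex outside `A` gains none, because no monochromatic
    -- edge enters `A`. The weight parameter `d` may lie below the target defect `d′`, as the sparse
    -- case requires.
    extend : ∀ {S A : V → Bool} {d} → d ≤ d′ → Reducible S A d k →
      Colourable (S ∖ A) → Colourable S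
    extend {S} {A} {d} d≤d′ red (c , c∈ , cdef)
      with c′ , c′∈ , c′off , c′def ← recolour d (crossWeight S A d)
             (crossWeight-sym S A d) (crossWeight-irr S A d) (lists L) (unique L) A
             (λ v Av → <-≤-trans (red v Av) (*-monoʳ-≤ (suc d) (big L v))) c c∈
      = c′ , c′∈ , bound
      where
      inside : ∀ v → A v ≡ true → ∀ u →
        ⟦ edgeOn S v u ∧ (c′ u ≡ᵇ c′ v) ⟧ ≤ crossWeight S A d v u * ⟦ c′ u ≡ᵇ c′ v ⟧
      inside v Av u rewrite Av with edgeOn S v u | A u | c′ u ≡ᵇ c′ v
      ... | false | _     | _     = z≤n
      ... | true  | _     | false = z≤n
      ... | true  | true  | true  = s≤s z≤n
      ... | true  | false | true  = s≤s z≤n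

      -- A monochromatic edge from u ∈ A to v ∉ A would alone weigh d + 1 at u.
      noCross : ∀ v u → A v ≡ false → A u ≡ true →
        edgeOn S v u ∧ (c′ u ≡ᵇ c′ v) ≡ true → d < d
      noCross v u Av Au e = begin-strict
        d                  <⟨ n<1+n d ⟩
        suc d              ≡⟨ termAt ⟨
        crossWeight S A d u v * ⟦ c′ v ≡ᵇ c′ u ⟧
          ≤⟨ term≤sumF (λ x → crossWeight S A d u x * ⟦ c′ x ≡ᵇ c′ u ⟧) v ⟩
        sumF (λ x → crossWeight S A d u x * ⟦ c′ x ≡ᵇ c′ u ⟧)
          ≤⟨ c′def u Au ⟩
        d ∎
        where
        open ≤-Reasoning
        termAt : crossWeight S A d u v * ⟦ c′ v ≡ᵇ c′ u ⟧ ≡ suc d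
        termAt rewrite edgeOn-sym S u v | ≡ᵇ-sym (c′ v) (c′ u) | Av | Au
          with edgeOn S v u | c′ u ≡ᵇ c′ v
        ... | true | true = trans (*-identityʳ _) (+-identityʳ _)

      outside : ∀ v → A v ≡ false → ∀ u →
        ⟦ edgeOn S v u ∧ (c′ u ≡ᵇ c′ v) ⟧ ≤ ⟦ edgeOn (S ∖ A) v u ∧ (c u ≡ᵇ c v) ⟧
      outside v Av u with A u in Au
      ... | false rewrite Av | c′off v Av | c′off u Au
                        | ∧-identityʳ (S v) | ∧-identityʳ (S u) = ≤-refl
      ... | true with edgeOn S v u ∧ (c′ u ≡ᵇ c′ v) in e
      ...   | false = z≤n
      ...   | true  = contradiction (noCross v u Av Au e) (<-irrefl refl)

      bound : ∀ v → S v ≡ true → sumF (λ u → ⟦ edgeOn S v u ∧ (c′ u ≡ᵇ c′ v) ⟧) ≤ d′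
      bound v Sv with A v in Av
      ... | true  = ≤-trans (sumF-mono (inside v Av)) (≤-trans (c′def v Av) d≤d′)
      ... | false = ≤-trans (sumF-mono (outside v Av))
        (cdef v (cong₂ (λ a b → a ∧ not b) Sv Av))

  -- Finding reducible sets by deletion counting.

  module _ (S : V → Bool) (d k : ℕ) where

    degOn : V → ℕ
    degOn v = sumF (λ u → ⟦ edgeOn S v u ⟧)

    -- For `v` in `A` the row sum is the degree of `v` inside `A`; the double sum is twice the
    -- number of edges of `S` inside `A`.
    within : (V → Bool) → V → V → ℕ
    within A v u = ⟦ edgeOn S v u ⟧ * (⟦ A v ⟧ * ⟦ A u ⟧)

    within-sym : ∀ A u v → within A u v ≡ within A v u
    within-sym A u v =
      cong₂ _*_ (cong ⟦_⟧ (edgeOn-sym S u v)) (*-comm ⟦ A u ⟧ ⟦ A v ⟧)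

    within-irr : ∀ A v → within A v v ≡ 0
    within-irr A v rewrite edgeOn-irr S v = refl

    -- The sum of the deletion inequalities over `A`, doubled so that the edges inside `A` are
    -- counted by the double sum of `within A`.
    Dense : (V → Bool) → Set
    Dense A = 2 * (suc d * k) * size A + d * sumF (λ v → sumF (within A v))
      ≤ 2 * suc d * sumF (λ v → ⟦ A v ⟧ * degOn v)

    -- An edge inside `A` contributes 1 + d and an edge leaving `A` contributes (d + 1) + 0, so
    -- every edge of `S` at `v` counts `suc d` times.
    crossWeight+within : ∀ A v → A v ≡ true →
      sumF (crossWeight S A d v) + d * sumF (within A v) ≡ suc d * degOn v
    crossWeight+within A v Av = begin
      sumF (crossWeight S A d v) + d * sumF (within A v)
        ≡⟨ cong (sumF (crossWeight S A d v) +_) (sumF-* d (within A v)) ⟨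
      sumF (crossWeight S A d v) + sumF (λ u → d * within A v u)
        ≡⟨ sumF-+ (crossWeight S A d v) (λ u → d * within A v u) ⟨
      sumF (λ u → crossWeight S A d v u + d * within A v u)
        ≡⟨ sumF-cong pointwise ⟩
      sumF (λ u → suc d * ⟦ edgeOn S v u ⟧)
        ≡⟨ sumF-* (suc d) (λ u → ⟦ edgeOn S v u ⟧) ⟩
      suc d * degOn v ∎
      where
      open ≡-Reasoning
      both : ∀ e d → e * 1 + d * (e * (1 * 1)) ≡ suc d * e
      both = solve-∀
      one : ∀ e d → e * suc d + d * (e * (1 * 0)) ≡ suc d * e
      one = solve-∀
      pointwise : ∀ u → crossWeight S A d v u + d * within A v u ≡ suc d * ⟦ edgeOn S v u ⟧
      pointwise u rewrite Av with A u
      ... | true  = both ⟦ edgeOn S v u ⟧ d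
      ... | false = one ⟦ edgeOn S v u ⟧ d

    -- Restoring `v` adds 1 to the size, `degOn v` to the degree sum and twice the degree of `v`
    -- inside `A` to the double sum. The change in the inequality is twice the heaviness of `v`,
    -- rewritten by `crossWeight+within`.
    dense-step : ∀ A v → A v ≡ true → suc d * k ≤ sumF (crossWeight S A d v) →
      Dense (updateAt A v (const false)) → Dense A
    dense-step A v Av heavy dense = begin
      2 * K * size A + d * E A
        ≡⟨ cong₂ (λ s e → 2 * K * s + d * e) size≡ E≡ ⟩
      2 * K * (size A′ + 1) + d * (E A′ + 2 * sumF (within A v))
        ≡⟨ regroup K (size A′) d (E A′) (sumF (within A v)) ⟩
      (2 * K * size A′ + d * E A′) + 2 * (K + d * sumF (within A v))
        ≤⟨ +-mono-≤ dense (*-monoʳ-≤ 2 (+-monoˡ-≤ (d * sumF (within A v)) heavy)) ⟩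
      2 * suc d * D A′ + 2 * (sumF (crossWeight S A d v) + d * sumF (within A v))
        ≡⟨ cong (λ t → 2 * suc d * D A′ + 2 * t) (crossWeight+within A v Av) ⟩
      2 * suc d * D A′ + 2 * (suc d * degOn v)
        ≡⟨ collect (suc d) (D A′) (degOn v) ⟩
      2 * suc d * (D A′ + degOn v)
        ≡⟨ cong (2 * suc d *_) D≡ ⟨
      2 * suc d * D A ∎
      where
      open ≤-Reasoning
      K = suc d * k
      A′ = updateAt A v (const false)
      E D : (V → Bool) → ℕ
      E B = sumF (λ u → sumF (within B u))
      D B = sumF (λ u → ⟦ B u ⟧ * degOn u)
      at : A′ v ≡ false
      at = updateAt-updates v A
      off : ∀ u → u ≢ v → A u ≡ A′ u
      off u u≢v = sym (updateAt-minimal u v A u≢v)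
      regroup : ∀ K s d e w →
        2 * K * (s + 1) + d * (e + 2 * w) ≡ (2 * K * s + d * e) + 2 * (K + d * w)
      regroup = solve-∀
      collect : ∀ m x y → 2 * m * x + 2 * (m * y) ≡ 2 * m * (x + y)
      collect = solve-∀
      size≡ : size A ≡ size A′ + 1
      size≡ = trans (sym (+-identityʳ _))
        (trans (cong (λ b → size A + ⟦ b ⟧) (sym at))
        (trans (sumF-change _ _ v λ u u≢v → cong ⟦_⟧ (off u u≢v))
          (cong (λ b → size A′ + ⟦ b ⟧) Av)))
      D≡ : D A ≡ D A′ + degOn v
      D≡ = trans (sym (+-identityʳ _))
        (trans (cong (λ b → D A + ⟦ b ⟧ * degOn v) (sym at))
        (trans (sumF-change _ _ v λ u u≢v → cong (λ b → ⟦ b ⟧ * degOn u) (off u u≢v))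
        (trans (cong (λ b → D A′ + ⟦ b ⟧ * degOn v) Av)
          (cong (D A′ +_) (*-identityˡ _)))))
      empty : sumF (within A′ v) ≡ 0
      empty = sumF-0 λ u →
        trans (cong (λ b → ⟦ edgeOn S v u ⟧ * (⟦ b ⟧ * ⟦ A′ u ⟧)) at) (*-zeroʳ ⟦ edgeOn S v u ⟧)
      E≡ : E A ≡ E A′ + 2 * sumF (within A v)
      E≡ = trans (sym (+-identityʳ _))
        (trans (cong (λ z → E A + 2 * z) (sym empty))
        (sumF²-change (within A) (within A′) v (within-sym A) (within-sym A′)
          (within-irr A v) (within-irr A′ v)
          λ u x u≢v x≢v → cong₂ (λ a b → ⟦ edgeOn S u x ⟧ * (⟦ a ⟧ * ⟦ b ⟧))
            (off u u≢v) (off x x≢v)))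

    dense-empty : ∀ A → (∀ v → A v ≡ false) → Dense A
    dense-empty A A≡∅ = ≤-trans (≤-reflexive lhs≡0) z≤n
      where
      E≡0 : sumF (λ v → sumF (within A v)) ≡ 0
      E≡0 = sumF-0 λ v → sumF-0 λ u →
        trans (cong (λ b → ⟦ edgeOn S v u ⟧ * (⟦ b ⟧ * ⟦ A u ⟧)) (A≡∅ v))
          (*-zeroʳ ⟦ edgeOn S v u ⟧)
      size≡0 : size A ≡ 0
      size≡0 = sumF-0 λ v → cong ⟦_⟧ (A≡∅ v)
      lhs≡0 : 2 * (suc d * k) * size A + d * sumF (λ v → sumF (within A v)) ≡ 0
      lhs≡0 = cong₂ _+_ (trans (cong (2 * (suc d * k) *_) size≡0) (*-zeroʳ (2 * (suc d * k))))
        (trans (cong (d *_) E≡0) (*-zeroʳ d))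

    -- Heavy vertices are deleted until none is left: the remaining set is reducible if nonempty,
    -- and otherwise `Dense` is carried back up from the empty set. The bound `m` makes the
    -- recursion structural.
    reducible-or-dense : ∀ m A → size A ≤ m → A ⊆ S →
      (∃[ B ] B ⊆ S × (∃[ v ] B v ≡ true) × Reducible S B d k) ⊎ Dense A
    reducible-or-dense m A size≤m A⊆S
      with any? (λ v → A v ≟ᵇ true ×-dec suc d * k ≤? sumF (crossWeight S A d v))
         | any? (λ v → A v ≟ᵇ true)
    ... | no none | yes nonempty =
      inj₁ (A , A⊆S , nonempty , λ v Av → ≰⇒> λ heavy → none (v , Av , heavy))
    ... | no none | no empty = inj₂ (dense-empty A λ v → ¬true v)
      where
      ¬true : ∀ v → A v ≡ false
      ¬true v with A v in Av
      ... | true  = contradiction (v , Av) empty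
      ... | false = refl
    ... | yes (v , Av , heavy) | _ = go m size≤m
      where
      A′ = updateAt A v (const false)
      A′⊆S : A′ ⊆ S
      A′⊆S u A′u with u ≟ᶠ v
      ... | yes refl = contradiction (trans (sym A′u) (updateAt-updates v A)) λ ()
      ... | no u≢v   = A⊆S u (trans (sym (updateAt-minimal u v A u≢v)) A′u)
      size< : size A′ < size A
      size< = ≤-reflexive (begin
        suc (size A′)         ≡⟨ +-comm 1 (size A′) ⟩
        size A′ + 1           ≡⟨ cong (λ b → size A′ + ⟦ b ⟧) Av ⟨
        size A′ + ⟦ A v ⟧     ≡⟨ sumF-change _ _ v (λ u u≢v → cong ⟦_⟧ (updateAt-minimal u v A u≢v)) ⟩
        size A + ⟦ A′ v ⟧     ≡⟨ cong (λ b → size A + ⟦ b ⟧) (updateAt-updates v A) ⟩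
        size A + 0            ≡⟨ +-identityʳ _ ⟩
        size A                ∎)
        where open ≡-Reasoning
      -- The case split on `m` waits until here because only a deletion consumes a unit of it.
      go : ∀ m → size A ≤ m → _
      go zero    size≤0 = contradiction (<-≤-trans size< size≤0) λ ()
      go (suc m) size≤m with reducible-or-dense m A′ (≤-pred (<-≤-trans size< size≤m)) A′⊆S
      ... | inj₁ found = inj₁ found
      ... | inj₂ dense = inj₂ (dense-step A v Av heavy dense)

    numVert-induced : numVert (induced S) ≡ size S
    numVert-induced = count≡sumF S

    degSum-induced : degSum (induced S) ≡ sumF degOn
    degSum-induced = sumF-cong λ v → count≡sumF (edgeOn S v)

    -- On all of `S` the matrix `within S` is the edge indicator, so both double sums are the degree
    -- sum, and 2(d + 1) - d = d + 2.
    dense⇒avgdeg : Dense S →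
      (2 * d + 2) * k * numVert (induced S) ≤ degSum (induced S) * (d + 2)
    dense⇒avgdeg dense rewrite numVert-induced | degSum-induced =
      +-cancelʳ-≤ (d * sumF degOn) _ _ (begin
        (2 * d + 2) * k * size S + d * sumF degOn
          ≡⟨ cong₂ (λ x y → x + d * y) (lhs d k (size S)) (sumF-cong λ v → sumF-cong (full v)) ⟩
        2 * (suc d * k) * size S + d * sumF (λ v → sumF (within S v))
          ≤⟨ dense ⟩
        2 * suc d * sumF (λ v → ⟦ S v ⟧ * degOn v)
          ≤⟨ *-monoʳ-≤ (2 * suc d) (sumF-mono λ v → ⟦⟧*≤ (S v) (degOn v)) ⟩
        2 * suc d * sumF degOn
          ≡⟨ rhs d (sumF degOn) ⟩
        sumF degOn * (d + 2) + d * sumF degOn ∎)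
      where
      open ≤-Reasoning
      lhs : ∀ d k s → (2 * d + 2) * k * s ≡ 2 * (suc d * k) * s
      lhs = solve-∀
      rhs : ∀ d e → 2 * suc d * e ≡ e * (d + 2) + d * e
      rhs = solve-∀
      ⟦⟧*≤ : ∀ b m → ⟦ b ⟧ * m ≤ m
      ⟦⟧*≤ true  m = ≤-reflexive (+-identityʳ m)
      ⟦⟧*≤ false m = z≤n
      full : ∀ v u → ⟦ edgeOn S v u ⟧ ≡ within S v u
      full v u with S v | S u
      ... | true  | true  = sym (*-identityʳ _)
      ... | true  | false = refl
      ... | false | _     = refl

    sparse⇒reducible : ∀ {n₀} → n₀ ≤ size S → MadLess G n₀ ((2 * d + 2) * k) (d + 2) →
      ∃[ B ] B ⊆ S × (∃[ v ] B v ≡ true) × Reducible S B d k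
    sparse⇒reducible n₀≤ mad with reducible-or-dense (size S) S ≤-refl (λ _ Sv → Sv)
    ... | inj₁ found = found
    ... | inj₂ dense = contradiction (dense⇒avgdeg dense)
      (<⇒≱ (mad (induced S) (subst (_ ≤_) (sym numVert-induced) n₀≤)))

    -- With `A = S` every edge weighs 1, so the weight at `v` is its degree in `S`, at most `size S`
    -- minus 1.
    small⇒reducible : size S ≤ suc d * k → Reducible S S d k
    small⇒reducible small v Sv = <-≤-trans (begin-strict
      sumF (crossWeight S S d v)                   ≤⟨ m≤m+n _ _ ⟩
      sumF (crossWeight S S d v) + 0               <⟨ +-monoʳ-< _ (s≤s z≤n) ⟩
      sumF (crossWeight S S d v) + 1               ≡⟨ cong (λ b → sumF (crossWeight S S d v) + ⟦ b ⟧) Sv ⟨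
      sumF (crossWeight S S d v) + ⟦ S v ⟧         ≤⟨ exclude-v ⟩
      size S ∎) small
      where
      open ≤-Reasoning
      -- Removing `v` itself, which is not its own neighbour, yields the strict inequality.
      S′ = updateAt S v (const false)
      pointwise : ∀ u → crossWeight S S d v u ≤ ⟦ S′ u ⟧
      pointwise u with u ≟ᶠ v
      ... | yes refl rewrite edgeOn-irr S u = z≤n
      ... | no u≢v rewrite updateAt-minimal u v {const false} S u≢v | Sv with S u | adj G v u
      ...   | true  | true  = ≤-refl
      ...   | true  | false = z≤n
      ...   | false | _     = z≤n
      exclude-v : sumF (crossWeight S S d v) + ⟦ S v ⟧ ≤ size S
      exclude-v = begin
        sumF (crossWeight S S d v) + ⟦ S v ⟧  ≤⟨ +-monoˡ-≤ ⟦ S v ⟧ (sumF-mono pointwise) ⟩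
        size S′ + ⟦ S v ⟧  ≡⟨ sumF-change _ _ v (λ u u≢v → cong ⟦_⟧ (updateAt-minimal u v S u≢v)) ⟩
        size S + ⟦ S′ v ⟧  ≡⟨ cong (λ b → size S + ⟦ b ⟧) (updateAt-updates v S) ⟩
        size S + 0         ≡⟨ +-identityʳ _ ⟩
        size S             ∎

-- Rounding up and the induction on the vertex set.

≤ceilDiv* : ∀ m k → 1 ≤ k → m ≤ ceilDiv m k * k
≤ceilDiv* m (suc k) _ = +-cancelʳ-≤ k _ _ (begin
  m + k                                              ≡⟨ m≡m%n+[m/n]*n (m + k) (suc k) ⟩
  (m + k) % suc k + (m + k) / suc k * suc k          ≤⟨ +-monoˡ-≤ _ (≤-pred (m%n<n (m + k) (suc k))) ⟩
  k + (m + k) / suc k * suc k                        ≡⟨ +-comm k _ ⟩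
  (m + k) / suc k * suc k + k                        ∎)
  where open ≤-Reasoning

theorem7 : (d n0 k : ℕ) → 1 ≤ n0 → 1 ≤ k → (G : Graph) →
    MadLess G n0 ((2 * d + 2) * k) (d + 2) →
    ChoosableWithDefect G k ((ceilDiv (n0 ∸ 1) k ∸ 1) ⊔ d)
theorem7 d n0 k 1≤n0 1≤k G mad L =
  -- Strong induction on `size S`, applied to the full vertex set, where `edgeOn` computes to
  -- `adj G`.
  let c , c∈ , cdef = <-rec Goal step _ (const true) refl
  in c , c∈ , λ v → ≤-trans (≤-reflexive (count≡sumF λ u → adj G v u ∧ (c u ≡ᵇ c v))) (cdef v refl)
  where
  d′ = (ceilDiv (n0 ∸ 1) k ∸ 1) ⊔ d
  Goal : ℕ → Set
  Goal m = ∀ S → size S ≡ m → Colourable G L d′ S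

  first : ∀ (l : List ℕ) → k ≤ length l → ∃ (_∈ l)
  first []      k≤0 = contradiction (≤-trans 1≤k k≤0) λ ()
  first (x ∷ l) _   = x , here refl

  ∖-self : ∀ b → b ∧ not b ≡ false
  ∖-self true  = refl
  ∖-self false = refl

  -- A ceiling is at most 1 plus its truncated predecessor, even when it is 0, as happens for
  -- `n0 = 1`.
  bound : n0 ∸ 1 ≤ suc d′ * k
  bound = ≤-trans (≤ceilDiv* (n0 ∸ 1) k 1≤k) (*-monoˡ-≤ k
    (≤-trans (m≤n+m∸n (ceilDiv (n0 ∸ 1) k) 1) (s≤s (m≤m⊔n _ d))))

  step : ∀ m → (∀ {m′} → m′ < m → Goal m′) → Goal m
  step m rec S refl with n0 ≤? size S
  ... | no n0≰ = extend G L d′ ≤-refl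
    (small⇒reducible G S d′ k (≤-trans (∸-monoˡ-≤ 1 (≰⇒> n0≰)) bound))
    -- Removing `S` from itself leaves no vertex with a defect condition, so any choice from the
    -- lists is a valid start.
    ( (λ v → proj₁ (first (lists L v) (big L v)))
    , (λ v → proj₂ (first (lists L v) (big L v)))
    , λ v Sv → contradiction (trans (sym Sv) (∖-self (S v))) λ ())
  ... | yes n0≤ with B , B⊆S , (v , Bv) , red ← sparse⇒reducible G S d k n0≤ mad =
    -- Here the weights use `d`, matching the sparsity hypothesis, while the defect to be preserved
    -- is `d′`.
    extend G L d′ (m≤n⊔m _ d) red (rec smaller (S ∖ B) refl)
    where
    smaller : size (S ∖ B) < size S
    smaller = begin-strict
      size (S ∖ B)           ≡⟨ +-identityʳ _ ⟨
      size (S ∖ B) + 0       <⟨ +-monoʳ-< _ (≤-trans (≤-reflexive (cong ⟦_⟧ (sym Bv))) (term≤sumF _ v)) ⟩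
      size (S ∖ B) + size B  ≡⟨ size-∖ B⊆S ⟩
      size S                 ∎
      where open ≤-Reasoning
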